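{- Let $G$ be a distance-hereditary graph, let $x,y$ be a diametral pair of vertices of $G$ (i.e. $d_G(x,y)=\operatorname{diam}(G)$), and let $k$ be the minimum eccentricity of a shortest path in $G$ (the minimum of $\operatorname{ecc}(P)$ over all shortest paths $P$ of $G$). Then there is a shortest path $P$ between $x$ and $y$ with $\operatorname{ecc}(P)=k$.
   Context: All graphs are finite, connected, unweighted, undirected, without loops or multiple edges. $d_G(u,v)$ is the length (number of edges) of a shortest $u$–$v$ path; for $S\subseteq V$, $d_G(v,S)=\min_{u\in S}d_G(u,v)$, and the eccentricity of a vertex set (or path) $S$ is $\operatorname{ecc}(S)=\max_{u\in V}d_G(u,S)$. $\operatorname{diam}(G)=\max_{u,v}d_G(u,v)$. A graph is distance-hereditary if distances in every connected induced subgraph equal the distances in $G$ (equivalently, every induced path is a shortest path). -}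

module Defs where

open import Data.Nat using (ℕ; zero; suc; _≤_)
open import Data.Fin using (Fin)
open import Data.Bool using (Bool; true; false)
open import Data.Unit using (⊤)
open import Data.Product using (Σ; ∃; ∃-syntax; _×_; _,_)
open import Relation.Binary.PropositionalEquality using (_≡_)
open import Data.Sum using (_⊎_)

record SimpleGraph (n : ℕ) : Set where
  field
    adj    : Fin n → Fin n → Bool
    sym    : ∀ u v → adj u v ≡ adj v u
    irrefl : ∀ u → adj u u ≡ false
open SimpleGraph public

module _ {n : ℕ} (G : SimpleGraph n) where

  -- Walks from u to w of length l (number of edges) all of whose
  -- vertices lie in the vertex set S (S = everything: walks in G;
  -- general S: walks in the induced subgraph G[S]).
  data WalkIn (S : Fin n → Set) : Fin n → Fin n → ℕ → Set where
    [_]  : ∀ {u} → S u → WalkIn S u u 0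
    _∷⟨_⟩_ : ∀ {u v w l} → S u → adj G u v ≡ true → WalkIn S v w l →
             WalkIn S u w (suc l)

  Walk : Fin n → Fin n → ℕ → Set
  Walk = WalkIn (λ _ → ⊤)

  IsDistIn : (Fin n → Set) → Fin n → Fin n → ℕ → Set
  IsDistIn S u v d = WalkIn S u v d × (∀ {l} → WalkIn S u v l → d ≤ l)

  IsDist : Fin n → Fin n → ℕ → Set
  IsDist = IsDistIn (λ _ → ⊤)

  ConnectedIn : (Fin n → Set) → Set
  ConnectedIn S = ∀ u v → S u → S v → ∃[ l ] WalkIn S u v l

  Connected : Set
  Connected = ∀ u v → ∃[ l ] Walk u v l

  DistanceHereditary : Set₁
  DistanceHereditary =
    ∀ (S : Fin n → Set) → ConnectedIn S →
    ∀ u v d → S u → S v → IsDist u v d → IsDistIn S u v d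

  IsDiam : ℕ → Set
  IsDiam D = (∃[ u ] ∃[ v ] IsDist u v D) ×
             (∀ u v d → IsDist u v d → d ≤ D)

  Diametral : Fin n → Fin n → Set
  Diametral x y = ∃[ D ] (IsDiam D × IsDist x y D)

  _∈W_ : ∀ {u w l} → Fin n → Walk u w l → Set
  _∈W_ {u = u} z [ _ ] = z ≡ u
  _∈W_ {u = u} z (_ ∷⟨ _ ⟩ p) = (z ≡ u) ⊎ (z ∈W p)

  record ShortestPath : Set where
    constructor sp
    field
      {src tgt} : Fin n
      len  : ℕ
      walk : Walk src tgt len
      isShortest : IsDist src tgt len
  open ShortestPath public

  DistToPath≤ : Fin n → ShortestPath → ℕ → Set
  DistToPath≤ v P e = ∃[ u ] (u ∈W walk P × ∃[ d ] (IsDist u v d × d ≤ e))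

  IsEcc : ShortestPath → ℕ → Set
  IsEcc P e = (∀ v → DistToPath≤ v P e) ×
              (∃[ v ] (∀ e' → DistToPath≤ v P e' → e ≤ e'))

  IsMinEccSP : ℕ → Set
  IsMinEccSP k = (∃[ P ] IsEcc P k) ×
                 (∀ P e → IsEcc P e → k ≤ e)

{-# OPTIONS --safe #-}
module Submission where

-- In a distance-hereditary graph every walk from u to v meets every distance sphere around u, up to
-- radius d(u,v), in a vertex lying on a geodesic from u to v (on-walk). Let D = d(x,y) be the
-- diameter and q a geodesic of length l within distance k of all vertices, cut down until l ≤ 1 or
-- each end covers a private vertex.
--   D < 2k: every geodesic from x to y works; a vertex v farther than k from it would have a vertex
--     at distance at most D - k from both x and y.
--   D ≥ 2k + l: q runs from a vertex near x to a vertex near y and extends to a geodesic.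
--   l ≥ 2: the private vertices of the ends are at distance 2k + l, so D ≥ 2k + l.
--   l = 1, D = 2k: some end of q is a midpoint of x and y, and the geodesics through it cover
--     unless the other end is a midpoint too; then one of the two can be used.

open import Defs
open import Data.Nat using (ℕ; zero; suc; _+_; _≤_; _<_; z≤n; s≤s; _≤?_)
open import Data.Nat.Properties
open import Algebra.Properties.CommutativeSemigroup +-commutativeSemigroup using (interchange)
open import Data.Fin using (Fin)
import Data.Fin.Properties as Fin
open import Data.Bool using (true; false)
import Data.Bool.Properties as Bool
open import Data.Unit using (tt)
open import Data.Sum as Sum using (_⊎_; inj₁; inj₂)
open import Data.Product using (Σ; ∃-syntax; _×_; _,_; proj₁; proj₂)
open import Function using (_∘_; case_of_)
open import Relation.Nullary using (Dec; yes; no; contradiction)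
open import Relation.Nullary.Decidable using (map′; _×-dec_; _⊎-dec_)
open import Relation.Unary using (Decidable; _⊆_)
open import Relation.Binary.PropositionalEquality
  using (_≡_; _≢_; refl; trans; cong; cong₂; subst) renaming (sym to ≡-sym)

-- Preliminaries on natural numbers.

least : ∀ {p} {P : ℕ → Set p} → Decidable P → ∀ m → P m →
        ∃[ l ] (P l × (∀ {j} → P j → l ≤ j))
least P? m pm with P? 0
... | yes p0 = 0 , p0 , λ _ → z≤n
least P? zero pm | no ¬p0 = contradiction pm ¬p0
least {P = P} P? (suc m) pm | no ¬p0 with least (λ j → P? (suc j)) m pm
... | l , pl , min = suc l , pl , λ { {zero} p0 → contradiction p0 ¬p0 ; {suc j} pj → s≤s (min pj) }

m+n≤o∧o≤n⇒m≡0 : ∀ {m n o} → m + n ≤ o → o ≤ n → m ≡ 0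
m+n≤o∧o≤n⇒m≡0 {m} {n} h h′ = n≤0⇒n≡0 (+-cancelʳ-≤ n m 0 (≤-trans h h′))

-- Walks and their vertex sets.

module Walks {n : ℕ} (G : SimpleGraph n) where

  infix 4 _∈_
  _∈_ : ∀ {u w l} → Fin n → Walk G u w l → Set
  z ∈ p = _∈W_ G z p

  Adj : Fin n → Fin n → Set
  Adj u v = adj G u v ≡ true

  adj-sym : ∀ {u v} → Adj u v → Adj v u
  adj-sym {u} {v} e = trans (sym G v u) e

  module _ {S : Fin n → Set} where

    source∈ : ∀ {u v l} → WalkIn G S u v l → S u
    source∈ [ s ] = s
    source∈ (s ∷⟨ _ ⟩ _) = s

    snoc : ∀ {u v w l} → WalkIn G S u v l → Adj v w → S w → WalkIn G S u w (suc l)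
    snoc [ s ] e t = s ∷⟨ e ⟩ [ t ]
    snoc (s ∷⟨ e′ ⟩ p) e t = s ∷⟨ e′ ⟩ snoc p e t

    reverse : ∀ {u v l} → WalkIn G S u v l → WalkIn G S v u l
    reverse [ s ] = [ s ]
    reverse (s ∷⟨ e ⟩ p) = snoc (reverse p) (adj-sym e) s

    infixr 5 _++_
    _++_ : ∀ {u v w l m} → WalkIn G S u v l → WalkIn G S v w m → WalkIn G S u w (l + m)
    [ _ ] ++ q = q
    (s ∷⟨ e ⟩ p) ++ q = s ∷⟨ e ⟩ (p ++ q)

    split : ∀ {u v} t m → WalkIn G S u v (t + m) →
            ∃[ s ] (S s × WalkIn G S u s t × WalkIn G S s v m)
    split zero m p = _ , source∈ p , [ source∈ p ] , p
    split (suc t) m (s ∷⟨ e ⟩ p) with split t m p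
    ... | z , sz , p₁ , p₂ = z , sz , s ∷⟨ e ⟩ p₁ , p₂

    forget : ∀ {u v l} → WalkIn G S u v l → Walk G u v l
    forget [ _ ] = [ tt ]
    forget (_ ∷⟨ e ⟩ p) = tt ∷⟨ e ⟩ forget p

    forget-∈ : ∀ {u v l} (p : WalkIn G S u v l) → ∀ {z} → z ∈ forget p → S z
    forget-∈ [ s ] refl = s
    forget-∈ (s ∷⟨ _ ⟩ p) (inj₁ refl) = s
    forget-∈ (s ∷⟨ _ ⟩ p) (inj₂ z∈) = forget-∈ p z∈

  mapWalk : ∀ {S S′ : Fin n → Set} → S ⊆ S′ → ∀ {u v l} → WalkIn G S u v l → WalkIn G S′ u v l
  mapWalk f [ s ] = [ f s ]
  mapWalk f (s ∷⟨ e ⟩ p) = f s ∷⟨ e ⟩ mapWalk f p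

  first∈ : ∀ {u v l} (p : Walk G u v l) → u ∈ p
  first∈ [ _ ] = refl
  first∈ (_ ∷⟨ _ ⟩ _) = inj₁ refl

  last∈ : ∀ {u v l} (p : Walk G u v l) → v ∈ p
  last∈ [ _ ] = refl
  last∈ (_ ∷⟨ _ ⟩ p) = inj₂ (last∈ p)

  ∈-++⁻ : ∀ {u v w l m} (p : Walk G u v l) {q : Walk G v w m} {z} → z ∈ p ++ q → z ∈ p ⊎ z ∈ q
  ∈-++⁻ [ _ ] z∈ = inj₂ z∈
  ∈-++⁻ (_ ∷⟨ _ ⟩ p) (inj₁ eq) = inj₁ (inj₁ eq)
  ∈-++⁻ (_ ∷⟨ _ ⟩ p) (inj₂ z∈) = Sum.map₁ inj₂ (∈-++⁻ p z∈)

  ∈-++⁺ˡ : ∀ {u v w l m} (p : Walk G u v l) {q : Walk G v w m} {z} → z ∈ p → z ∈ p ++ q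
  ∈-++⁺ˡ [ _ ] {q} refl = first∈ q
  ∈-++⁺ˡ (_ ∷⟨ _ ⟩ p) (inj₁ eq) = inj₁ eq
  ∈-++⁺ˡ (_ ∷⟨ _ ⟩ p) (inj₂ z∈) = inj₂ (∈-++⁺ˡ p z∈)

  ∈-++⁺ʳ : ∀ {u v w l m} (p : Walk G u v l) {q : Walk G v w m} {z} → z ∈ q → z ∈ p ++ q
  ∈-++⁺ʳ [ _ ] z∈ = z∈
  ∈-++⁺ʳ (_ ∷⟨ _ ⟩ p) z∈ = inj₂ (∈-++⁺ʳ p z∈)

  ∈-snoc⁺ : ∀ {u v w l} (p : Walk G u v l) {e : Adj v w} {z} → z ∈ p ⊎ z ≡ w → z ∈ snoc p e tt
  ∈-snoc⁺ [ _ ] (inj₁ eq) = inj₁ eq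
  ∈-snoc⁺ [ _ ] (inj₂ eq) = inj₂ eq
  ∈-snoc⁺ (_ ∷⟨ _ ⟩ p) (inj₁ (inj₁ eq)) = inj₁ eq
  ∈-snoc⁺ (_ ∷⟨ _ ⟩ p) (inj₁ (inj₂ z∈)) = inj₂ (∈-snoc⁺ p (inj₁ z∈))
  ∈-snoc⁺ (_ ∷⟨ _ ⟩ p) (inj₂ eq) = inj₂ (∈-snoc⁺ p (inj₂ eq))

  ∈-snoc⁻ : ∀ {u v w l} (p : Walk G u v l) {e : Adj v w} {z} → z ∈ snoc p e tt → z ∈ p ⊎ z ≡ w
  ∈-snoc⁻ [ _ ] (inj₁ eq) = inj₁ eq
  ∈-snoc⁻ [ _ ] (inj₂ eq) = inj₂ eq
  ∈-snoc⁻ (_ ∷⟨ _ ⟩ p) (inj₁ eq) = inj₁ (inj₁ eq)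
  ∈-snoc⁻ (_ ∷⟨ _ ⟩ p) (inj₂ z∈) = Sum.map₁ inj₂ (∈-snoc⁻ p z∈)

  ∈-reverse⁺ : ∀ {u v l} (p : Walk G u v l) {z} → z ∈ p → z ∈ reverse p
  ∈-reverse⁺ [ _ ] eq = eq
  ∈-reverse⁺ (_ ∷⟨ _ ⟩ p) (inj₁ eq) = ∈-snoc⁺ (reverse p) (inj₂ eq)
  ∈-reverse⁺ (_ ∷⟨ _ ⟩ p) (inj₂ z∈) = ∈-snoc⁺ (reverse p) (inj₁ (∈-reverse⁺ p z∈))

  ∈-reverse⁻ : ∀ {u v l} (p : Walk G u v l) {z} → z ∈ reverse p → z ∈ p
  ∈-reverse⁻ [ _ ] eq = eq
  ∈-reverse⁻ (_ ∷⟨ _ ⟩ p) z∈ =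
    Sum.swap (Sum.map₁ (∈-reverse⁻ p) (∈-snoc⁻ (reverse p) z∈))

  ∈-split : ∀ {u v l} (p : Walk G u v l) {z} → z ∈ p →
            ∃[ i ] ∃[ j ] Σ (Walk G u z i) λ p₁ → Σ (Walk G z v j) λ p₂ →
              i + j ≡ l × (∀ {w} → w ∈ p → w ∈ p₁ ⊎ w ∈ p₂)
  ∈-split [ _ ] refl = 0 , 0 , [ tt ] , [ tt ] , refl , inj₁
  ∈-split (s ∷⟨ e ⟩ p) (inj₁ refl) = 0 , _ , [ tt ] , (s ∷⟨ e ⟩ p) , refl , inj₂
  ∈-split (s ∷⟨ e ⟩ p) (inj₂ z∈) with ∈-split p z∈
  ... | i , j , p₁ , p₂ , eq , f = suc i , j , (s ∷⟨ e ⟩ p₁) , p₂ , cong suc eq ,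
        λ { (inj₁ eq) → inj₁ (inj₁ eq) ; (inj₂ w∈) → Sum.map₁ inj₂ (f w∈) }

  prefix : ∀ {u v l} (p : Walk G u v l) {z} → z ∈ p → ∃[ i ] WalkIn G (_∈ p) u z i
  prefix [ _ ] refl = 0 , [ refl ]
  prefix (_ ∷⟨ _ ⟩ p) (inj₁ refl) = 0 , [ inj₁ refl ]
  prefix (_ ∷⟨ e ⟩ p) (inj₂ z∈) with prefix p z∈
  ... | i , q = suc i , inj₁ refl ∷⟨ e ⟩ mapWalk inj₂ q

  -- Any two vertices are joined through the start of `p`. This makes the vertex set of a walk an
  -- admissible set for `DistanceHereditary`.
  walk-connected : ∀ {u v l} (p : Walk G u v l) → ConnectedIn G (_∈ p)
  walk-connected p y z y∈ z∈ =
    _ , reverse (proj₂ (prefix p y∈)) ++ proj₂ (prefix p z∈)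

  walk? : ∀ u v → Decidable (Walk G u v)
  walk? u v zero = map′ (λ { refl → [ tt ] }) (λ { [ _ ] → refl }) (u Fin.≟ v)
  walk? u v (suc l) =
    map′ (λ (_ , e , p) → tt ∷⟨ e ⟩ p) (λ { (_ ∷⟨ e ⟩ p) → _ , e , p })
         (Fin.any? λ w → (adj G u w Bool.≟ true) ×-dec walk? w v l)

  _∈?_ : ∀ {u v l} z (p : Walk G u v l) → Dec (z ∈ p)
  _∈?_ {u = u} z [ _ ] = z Fin.≟ u
  _∈?_ {u = u} z (_ ∷⟨ _ ⟩ p) = (z Fin.≟ u) ⊎-dec (z ∈? p)

-- Distances and geodesics.

module Distance {n : ℕ} (G : SimpleGraph n) (conn : Connected G) where

  open Walks G

  abstract
    -- Kept abstract so that the search behind it is never unfolded; later steps rely on `IsDist`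
    -- alone.
    distance : ∀ u v → ∃[ l ] IsDist G u v l
    distance u v = least (walk? u v) (proj₁ (conn u v)) (proj₂ (conn u v))

  d : Fin n → Fin n → ℕ
  d u v = proj₁ (distance u v)

  geo : ∀ u v → Walk G u v (d u v)
  geo u v = proj₁ (proj₂ (distance u v))

  d-min : ∀ {u v l} → Walk G u v l → d u v ≤ l
  d-min {u} {v} p = proj₂ (proj₂ (distance u v)) p

  isDist⇒≡d : ∀ {u v l} → IsDist G u v l → l ≡ d u v
  isDist⇒≡d (p , min) = ≤-antisym (min (geo _ _)) (d-min p)

  d-refl : ∀ u → d u u ≡ 0
  d-refl u = n≤0⇒n≡0 (d-min [ tt ])

  d-sym : ∀ u v → d u v ≡ d v u
  d-sym u v = ≤-antisym (d-min (reverse (geo v u))) (d-min (reverse (geo u v)))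

  d-triangle : ∀ u v w → d u w ≤ d u v + d v w
  d-triangle u v w = d-min (geo u v ++ geo v w)

  d≡0⇒≡ : ∀ {u v} → d u v ≡ 0 → u ≡ v
  d≡0⇒≡ {u} {v} eq with d u v | geo u v
  d≡0⇒≡ refl | _ | [ _ ] = refl

  d-adj : ∀ {u v} → Adj u v → d u v ≤ 1
  d-adj e = d-min (tt ∷⟨ e ⟩ [ tt ])

  d-step : ∀ w {u v} → Adj u v → d w v ≤ suc (d w u)
  d-step w {u} {v} e = begin
    d w v          ≤⟨ d-triangle w u v ⟩
    d w u + d u v  ≤⟨ +-monoʳ-≤ (d w u) (d-adj e) ⟩
    d w u + 1      ≡⟨ +-comm (d w u) 1 ⟩
    suc (d w u)    ∎
    where open ≤-Reasoning

  d-∈ : ∀ {u v l} (p : Walk G u v l) {z} → z ∈ p → d u z + d z v ≤ l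
  d-∈ p z∈ with ∈-split p z∈
  ... | _ , _ , p₁ , p₂ , refl , _ = +-mono-≤ (d-min p₁) (d-min p₂)

  d-geo : ∀ u v {z} → z ∈ geo u v → d u z + d z v ≤ d u v
  d-geo u v = d-∈ (geo u v)

  geo-last : ∀ u v {z} → z ∈ geo u v → d u v ≤ d u z → z ≡ v
  geo-last u v {z} z∈ h =
    d≡0⇒≡ (m+n≤o∧o≤n⇒m≡0 (subst (_≤ d u v) (+-comm (d u z) _) (d-geo u v z∈)) h)

  geo-first : ∀ u v {z} → z ∈ geo u v → d u v ≤ d z v → z ≡ u
  geo-first u v {z} z∈ h = ≡-sym (d≡0⇒≡ (m+n≤o∧o≤n⇒m≡0 (d-geo u v z∈) h))

  next : ∀ {u v m} → d u v ≡ suc m → ∃[ w ] (Adj u w × d w v ≡ m)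
  next {u} {v} {m} eq with split 1 m (subst (Walk G u v) eq (geo u v))
  ... | w , _ , (_ ∷⟨ e ⟩ [ _ ]) , q =
        w , e , ≤-antisym (d-min q) (≤-pred (subst (_≤ suc (d w v)) eq (d-min (tt ∷⟨ e ⟩ geo w v))))

  d≡1⇒adj : ∀ {u v} → d u v ≡ 1 → Adj u v
  d≡1⇒adj eq with next eq
  ... | w , e , wv = subst (Adj _) (d≡0⇒≡ wv) e

  adj⇒d≢0 : ∀ {u v} → Adj u v → d u v ≢ 0
  adj⇒d≢0 {u} e eq =
    case trans (≡-sym e) (subst (λ w → adj G u w ≡ false) (d≡0⇒≡ eq) (irrefl G u)) of λ ()

  -- Splitting `p` at `y` leaves `z` in one of the two parts. That part already has length at least
  -- `d y z`, hence at least `l`, so the other part is empty and `z` sits at the far end of its own.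
  ends : ∀ {a b l} (p : Walk G a b l) {y z} → y ∈ p → z ∈ p → l ≤ d y z →
         (y ≡ a × z ≡ b) ⊎ (y ≡ b × z ≡ a)
  ends {a} {b} p {y} {z} y∈ z∈ h with ∈-split p y∈
  ... | i , j , p₁ , p₂ , refl , f with f z∈
  ...   | inj₁ z∈₁ = inj₂ (y≡b , z≡a)
    where
    open ≤-Reasoning
    tot : (j + d a z) + d z y ≤ d z y
    tot = begin
      (j + d a z) + d z y  ≡⟨ +-assoc j _ _ ⟩
      j + (d a z + d z y)  ≤⟨ +-monoʳ-≤ j (d-∈ p₁ z∈₁) ⟩
      j + i                ≡⟨ +-comm j i ⟩
      i + j                ≤⟨ h ⟩
      d y z                ≡⟨ d-sym y z ⟩
      d z y                ∎
    nil : j + d a z ≡ 0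
    nil = m+n≤o∧o≤n⇒m≡0 tot ≤-refl
    y≡b : y ≡ b
    y≡b = d≡0⇒≡ (n≤0⇒n≡0 (subst (d y b ≤_) (m+n≡0⇒m≡0 j nil) (d-min p₂)))
    z≡a : z ≡ a
    z≡a = ≡-sym (d≡0⇒≡ (m+n≡0⇒n≡0 j nil))
  ...   | inj₂ z∈₂ = inj₁ (y≡a , z≡b)
    where
    open ≤-Reasoning
    tot : (i + d z b) + d y z ≤ d y z
    tot = begin
      (i + d z b) + d y z  ≡⟨ +-assoc i _ _ ⟩
      i + (d z b + d y z)  ≡⟨ cong (i +_) (+-comm (d z b) _) ⟩
      i + (d y z + d z b)  ≤⟨ +-monoʳ-≤ i (d-∈ p₂ z∈₂) ⟩
      i + j                ≤⟨ h ⟩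
      d y z                ∎
    nil : i + d z b ≡ 0
    nil = m+n≤o∧o≤n⇒m≡0 tot ≤-refl
    y≡a : y ≡ a
    y≡a = ≡-sym (d≡0⇒≡ (n≤0⇒n≡0 (subst (d a y ≤_) (m+n≡0⇒m≡0 i nil) (d-min p₁))))
    z≡b : z ≡ b
    z≡b = d≡0⇒≡ (m+n≡0⇒n≡0 i nil)

  -- Covering by a walk within a given distance.

  Near Far : ∀ {u w l} → ℕ → Fin n → Walk G u w l → Set
  Near k v p = ∃[ z ] (z ∈ p × d v z ≤ k)
  Far k v p = ∀ {z} → z ∈ p → k < d v z

  Covers : ∀ {u w l} → ℕ → Walk G u w l → Set
  Covers k p = ∀ v → Near k v p

  near? : ∀ {u w l} k v (p : Walk G u w l) → Dec (Near k v p)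
  near? k v p = Fin.any? λ z → (z ∈? p) ×-dec (d v z ≤? k)

  covers? : ∀ {u w l} k (p : Walk G u w l) → Covers k p ⊎ ∃[ v ] Far k v p
  covers? k p with Fin.all? (λ v → near? k v p)
  ... | yes c = inj₁ c
  ... | no ¬c with Fin.¬∀⟶∃¬ n _ (λ v → near? k v p) ¬c
  ...   | v , ¬near = inj₂ (v , λ z∈ → ≰⇒> (λ h → ¬near (_ , z∈ , h)))

  covers-mono : ∀ {u w u′ w′ l l′ k} {p : Walk G u w l} {q : Walk G u′ w′ l′} →
                (∀ {z} → z ∈ p → z ∈ q) → Covers k p → Covers k q
  covers-mono f c v with c v
  ... | z , z∈ , h = z , f z∈ , h

-- Consequences of distance heredity.

module Hereditary {n : ℕ} (G : SimpleGraph n) (conn : Connected G) (dh : DistanceHereditary G) where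

  open Walks G
  open Distance G conn
  open ≤-Reasoning

  -- The vertices of `p` induce a connected subgraph, in which distances are those of `G`. It
  -- therefore contains a geodesic of `G` from `u` to `v`, and `s` is the vertex reached after `t`
  -- steps.
  on-walk : ∀ {u v l} (p : Walk G u v l) {t} → t ≤ d u v →
            ∃[ s ] (s ∈ p × d u s ≡ t × t + d s v ≡ d u v)
  on-walk {u} {v} p {t} t≤ with m≤n⇒∃[o]m+o≡n t≤
  ... | m , eq with dh (_∈ p) (walk-connected p) u v (d u v) (first∈ p) (last∈ p) (proj₂ (distance u v))
  ...   | q , _ with split t m (subst (WalkIn G (_∈ p) u v) (≡-sym eq) q)
  ...     | s , s∈ , q₁ , q₂ = s , s∈ , us≡t , trans (cong (t +_) sv≡m) eq
    where
    us≤t : d u s ≤ t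
    us≤t = d-min (forget q₁)
    sv≤m : d s v ≤ m
    sv≤m = d-min (forget q₂)
    t+m≤ : t + m ≤ d u s + d s v
    t+m≤ = subst (_≤ d u s + d s v) (≡-sym eq) (d-triangle u s v)
    us≡t : d u s ≡ t
    us≡t = ≤-antisym us≤t (+-cancelʳ-≤ m t (d u s) (≤-trans t+m≤ (+-monoʳ-≤ (d u s) sv≤m)))
    sv≡m : d s v ≡ m
    sv≡m = ≤-antisym sv≤m (+-cancelˡ-≤ t m (d s v) (≤-trans t+m≤ (+-monoˡ-≤ (d s v) us≤t)))

  -- The sphere of radius `d v b` around `v` meets `geo v b` followed by `p` only in `b`: the other
  -- vertices of the geodesic are too close, those of `p` too far. So `b` is the vertex given by
  -- `on-walk`.
  gate : ∀ v {b z l} (p : Walk G b z l) → (∀ {s} → s ∈ p → s ≡ b ⊎ d v b < d v s) →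
         d v b + d b z ≡ d v z
  gate v {b} {z} p far with on-walk (geo v b ++ p) b≤z
    where
    b≤z : d v b ≤ d v z
    b≤z with far (last∈ p)
    ... | inj₁ refl = ≤-refl
    ... | inj₂ h = <⇒≤ h
  ... | s , s∈ , vs , eq = subst (λ s → d v b + d s z ≡ d v z) s≡b eq
    where
    s≡b : s ≡ b
    s≡b with ∈-++⁻ (geo v b) s∈
    ... | inj₁ s∈₁ = geo-last v b s∈₁ (≤-reflexive (≡-sym vs))
    ... | inj₂ s∈₂ with far s∈₂
    ...   | inj₁ eq = eq
    ...   | inj₂ h = contradiction vs (>⇒≢ h)

  -- Seen from `y`, both `c` and `c′` lie beyond `p`. So `gate` along the walk `p`, `c`, `c′` puts
  -- `p` on a geodesic from `y` to `c′`, one step before its end.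
  lower-neighbour : ∀ {c c′ p y m} → Adj c c′ → Adj c p → d c y ≡ suc m → d c′ y ≡ suc m →
                    d p y ≡ m → Adj c′ p
  lower-neighbour {c} {c′} {p} {y} {m} e cp cy c′y py = adj-sym (d≡1⇒adj (+-cancelˡ-≡ m _ _ (begin-equality
    m + d p c′        ≡⟨ cong (_+ d p c′) yp ⟨
    d y p + d p c′    ≡⟨ gate y (tt ∷⟨ adj-sym cp ⟩ (tt ∷⟨ e ⟩ [ tt ]))
                           (λ { (inj₁ eq) → inj₁ eq
                              ; (inj₂ (inj₁ refl)) → inj₂ (above cy)
                              ; (inj₂ (inj₂ refl)) → inj₂ (above c′y) }) ⟩
    d y c′            ≡⟨ d-sym y c′ ⟩
    d c′ y            ≡⟨ c′y ⟩
    suc m             ≡⟨ +-comm 1 m ⟩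
    m + 1             ∎)))
    where
    yp : d y p ≡ m
    yp = trans (d-sym y p) py
    above : ∀ {z} → d z y ≡ suc m → d y p < d y z
    above {z} zy = ≤-reflexive (trans (cong suc yp) (trans (≡-sym zy) (d-sym z y)))

  -- `w` is the vertex at distance `k` from `v` found by `on-walk` on the route to `y` via `x`. It
  -- cannot lie on `p`, so it lies on `geo v x` and thus on geodesics to both ends.
  common-gate : ∀ {k v x y l} (p : Walk G x y l) → Far k v p →
                ∃[ w ] (k + d w x ≡ d v x × k + d w y ≡ d v y)
  common-gate {k} {v} {x} {y} p far
    with on-walk (geo v x ++ p) (<⇒≤ (far (last∈ p)))
  ... | w , w∈ , vw , eq with ∈-++⁻ (geo v x) w∈
  ...   | inj₂ w∈p = contradiction vw (>⇒≢ (far w∈p))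
  ...   | inj₁ w∈g = w , ≤-antisym (subst (λ t → t + d w x ≤ d v x) vw (d-geo v x w∈g))
                                   (subst (λ t → d v x ≤ t + d w x) vw (d-triangle v w x)) , eq

  -- Since d v′ p ≤ d v′ b, no geodesic from p to v′ passes through b, so the detour p, b, v, v′
  -- yields a vertex next to p between v and v′. This gives sum≤, i.e. v and v′ are far enough
  -- apart for on-walk to apply at radius d v b.
  joined : ∀ {v v′ b p a l} → Adj b p → (r : Walk G p a l) → Far (d v b) v r →
           d v′ a < d v′ p → d v′ p ≤ d v′ b → d v v′ ≡ d v b + d v′ b
  joined {v} {v′} {b} {p} {a} e r far a<p p≤b = total
    where
    sum≤ : d v b + d v′ a ≤ d v v′
    sum≤ with on-walk (tt ∷⟨ adj-sym e ⟩ (geo b v ++ geo v v′)) {1}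
                (subst (1 ≤_) (d-sym v′ p) (≤-trans (s≤s z≤n) a<p))
    ... | s , s∈ , ps , eq = go s∈
      where
      b≤s : d v b ≤ d v s
      b≤s = ≤-pred (begin
        suc (d v b)      ≤⟨ far (first∈ r) ⟩
        d v p            ≤⟨ d-triangle v s p ⟩
        d v s + d s p    ≡⟨ cong (d v s +_) (trans (d-sym s p) ps) ⟩
        d v s + 1        ≡⟨ +-comm (d v s) 1 ⟩
        suc (d v s)      ∎)
      vp : suc (d s v′) ≡ d v′ p
      vp = trans eq (d-sym p v′)
      go : s ∈ (tt ∷⟨ adj-sym e ⟩ (geo b v ++ geo v v′)) → d v b + d v′ a ≤ d v v′
      go (inj₁ refl) = case trans (≡-sym (d-refl p)) ps of λ ()
      go (inj₂ s∈′) with ∈-++⁻ (geo b v) s∈′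
      ... | inj₂ s∈g = ≤-trans
              (+-mono-≤ b≤s (≤-pred (subst (d v′ a <_) (≡-sym vp) a<p))) (d-geo v v′ s∈g)
      ... | inj₁ s∈g = contradiction
              (≤-trans (≤-reflexive vp) (≤-trans p≤b (≤-reflexive (trans (cong (d v′) (≡-sym s≡b)) (d-sym v′ s)))))
              (<⇒≱ ≤-refl)
        where
        s≡b : s ≡ b
        s≡b = geo-first b v s∈g (begin
          d b v  ≡⟨ d-sym b v ⟩
          d v b  ≤⟨ b≤s ⟩
          d v s  ≡⟨ d-sym v s ⟩
          d s v  ∎)

    -- The vertex found at radius `d v b` is not on `r`, which is farther away. On `geo a v′` it
    -- would be `a`, by `sum≤`, and `a` belongs to `r`. On `geo v b` only the end `b` has this
    -- radius.
    total : d v v′ ≡ d v b + d v′ b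
    total with on-walk (geo v b ++ (tt ∷⟨ e ⟩ (r ++ geo a v′))) (≤-trans (m≤m+n _ _) sum≤)
    ... | s , s∈ , vs , eq = trans (≡-sym eq) (cong (d v b +_) (trans (d-sym s v′) (cong (d v′) s≡b)))
      where
      s≡b : s ≡ b
      s≡b with ∈-++⁻ (geo v b) s∈
      ... | inj₁ s∈₁ = geo-last v b s∈₁ (≤-reflexive (≡-sym vs))
      ... | inj₂ (inj₁ s≡b) = s≡b
      ... | inj₂ (inj₂ s∈₂) with ∈-++⁻ r s∈₂
      ...   | inj₁ s∈r = contradiction vs (>⇒≢ (far s∈r))
      ...   | inj₂ s∈g = contradiction vs (>⇒≢ (far (subst (_∈ r) (≡-sym s≡a) (last∈ r))))
        where
        s≡a : s ≡ a
        s≡a = geo-first a v′ s∈g (begin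
          d a v′  ≡⟨ d-sym a v′ ⟩
          d v′ a  ≤⟨ +-cancelˡ-≤ (d v b) _ _ (≤-trans sum≤ (≤-reflexive (≡-sym eq))) ⟩
          d s v′  ∎)

  -- Geodesics between a diametral pair.

  module Diameter {x y : Fin n} (diam : ∀ u v → d u v ≤ d x y) (k : ℕ) where

    CoveringGeodesic : Set
    CoveringGeodesic = Σ (Walk G x y (d x y)) (Covers k)

    shortened : ∀ {l} (p : Walk G x y l) → l ≤ d x y → Covers k p → CoveringGeodesic
    shortened p l≤ c with ≤-antisym l≤ (d-min p)
    ... | refl = p , c

    small-diameter : d x y < k + k → CoveringGeodesic
    small-diameter D< with covers? k (geo x y)
    ... | inj₁ c = geo x y , c
    ... | inj₂ (v , far) with common-gate (geo x y) far
    ...   | w , wx , wy = contradiction (+-cancelʳ-≤ (d x y) _ _ bound) (<⇒≱ D<)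
      where
      -- Adds the two equations of `common-gate`; cancelling one `d x y` leaves `k + k ≤ d x y`.
      bound : k + k + d x y ≤ d x y + d x y
      bound = begin
        k + k + d x y                ≤⟨ +-monoʳ-≤ (k + k) (d-triangle x w y) ⟩
        k + k + (d x w + d w y)      ≡⟨ interchange k k (d x w) (d w y) ⟩
        k + d x w + (k + d w y)      ≡⟨ cong (λ t → k + t + (k + d w y)) (d-sym x w) ⟩
        k + d w x + (k + d w y)      ≡⟨ cong₂ _+_ wx wy ⟩
        d v x + d v y                ≤⟨ +-mono-≤ (diam v x) (diam v y) ⟩
        d x y + d x y                ∎

    through : ∀ {a b l} (q : Walk G a b l) → Covers k q → k + (k + l) ≤ d x y →
              d x a ≤ k → d y b ≤ k → CoveringGeodesic
    through {a} {b} {l} q c D≥ xa yb =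
      shortened (geo x a ++ (q ++ geo b y))
        (≤-trans (+-mono-≤ xa (subst (_≤ k + l) (+-comm (d b y) l)
           (+-monoˡ-≤ l (subst (_≤ k) (d-sym y b) yb)))) D≥)
        (covers-mono {p = q} (λ z∈ → ∈-++⁺ʳ (geo x a) (∈-++⁺ˡ q z∈)) c)

    -- The vertices of `q` that cover `x` and `y` are at distance at least `l` from each other. By
    -- `ends` they are the two ends of `q`, in one order or the other.
    large-diameter : ∀ {a b l} (q : Walk G a b l) → Covers k q → k + (k + l) ≤ d x y →
                     CoveringGeodesic
    large-diameter {l = l} q c D≥ with c x | c y
    ... | z , z∈ , xz | z′ , z′∈ , yz′ with ends q z∈ z′∈ (+-cancelˡ-≤ k _ _ (+-cancelˡ-≤ k _ _ bound))
      where
      bound : k + (k + l) ≤ k + (k + d z z′)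
      bound = begin
        k + (k + l)               ≤⟨ D≥ ⟩
        d x y                     ≤⟨ d-triangle x z y ⟩
        d x z + d z y             ≤⟨ +-mono-≤ xz (d-triangle z z′ y) ⟩
        k + (d z z′ + d z′ y)     ≡⟨ cong (λ t → k + (d z z′ + t)) (d-sym z′ y) ⟩
        k + (d z z′ + d y z′)     ≤⟨ +-monoʳ-≤ k (+-monoʳ-≤ (d z z′) yz′) ⟩
        k + (d z z′ + k)          ≡⟨ cong (k +_) (+-comm (d z z′) k) ⟩
        k + (k + d z z′)          ∎
    ...   | inj₁ (refl , refl) = through q c D≥ xz yz′
    ...   | inj₂ (refl , refl) =
            through (reverse q) (covers-mono {p = q} (∈-reverse⁺ q) c) D≥ xz yz′

    -- Any route from `x` to `y` contains a vertex at distance `k` from both. On a route along `q`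
    -- it lies in `q`, since `geo x z` and `geo z′ y` have length at most `k` and can contribute
    -- only `z` and `z′`.
    midpoint : ∀ {a b l} (q : Walk G a b l) → Covers k q → d x y ≡ k + k →
               ∃[ c ] (c ∈ q × d x c ≡ k × d c y ≡ k)
    midpoint q c D≡ with c x | c y
    ... | z , z∈ , xz | z′ , z′∈ , yz′ with walk-connected q z z′ z∈ z′∈
    ...   | _ , r with on-walk (geo x z ++ (forget r ++ geo z′ y)) (≤-trans (m≤m+n k k) (≤-reflexive (≡-sym D≡)))
    ...     | s , s∈ , xs , eq = s , s∈q , xs , sy
      where
      sy : d s y ≡ k
      sy = +-cancelˡ-≡ k _ _ (trans eq D≡)
      s∈q : s ∈ q
      s∈q with ∈-++⁻ (geo x z) s∈
      ... | inj₁ s∈₁ = subst (_∈ q) (≡-sym (geo-last x z s∈₁ (≤-trans xz (≤-reflexive (≡-sym xs))))) z∈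
      ... | inj₂ s∈′ with ∈-++⁻ (forget r) s∈′
      ...   | inj₁ s∈r = forget-∈ r s∈r
      ...   | inj₂ s∈₂ = subst (_∈ q) (≡-sym (geo-first z′ y s∈₂
                (≤-trans (≤-reflexive (d-sym z′ y)) (≤-trans yz′ (≤-reflexive (≡-sym sy)))))) z′∈

    -- The candidate runs through `c′` and `p`. A vertex `u′` far from it must be covered by `c`, so
    -- it is closer to `c` than to `p`. Then `joined` puts `c′` between `u` and `u′`, and their
    -- distance exceeds `k + k`.
    two-midpoints : ∀ {c c′ p u} → (∀ v → d v c ≤ k ⊎ d v c′ ≤ k) → d x y ≡ k + k →
                    (cp : Adj c p) → Adj c′ p → suc (d p y) ≡ k → d c′ x ≤ k → d u c′ ≡ k →
                    Far k u (tt ∷⟨ cp ⟩ geo p y) → CoveringGeodesic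
    two-midpoints {c} {c′} {p} {u} near D≡ cp c′p py c′x uc′ far
      with covers? k (geo x c′ ++ (tt ∷⟨ c′p ⟩ geo p y))
    ... | inj₁ cov = shortened _ (begin
            d x c′ + suc (d p y)  ≡⟨ cong₂ _+_ (d-sym x c′) py ⟩
            d c′ x + k            ≤⟨ +-monoˡ-≤ k c′x ⟩
            k + k                 ≡⟨ D≡ ⟨
            d x y                 ∎) cov
    ... | inj₂ (u′ , far′) = contradiction (diam u u′) (<⇒≱ (begin
            suc (d x y)         ≡⟨ cong suc D≡ ⟩
            suc (k + k)         ≡⟨ +-suc k k ⟨
            k + suc k           ≤⟨ +-monoʳ-≤ k u′c′ ⟩
            k + d u′ c′         ≡⟨ cong (_+ d u′ c′) uc′ ⟨
            d u c′ + d u′ c′    ≡⟨ joined c′p (tt ∷⟨ adj-sym cp ⟩ [ tt ])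
                                     (λ { (inj₁ refl) → above (inj₂ (first∈ (geo p y)))
                                        ; (inj₂ refl) → above (inj₁ refl) })
                                     (≤-<-trans u′c u′p)
                                     (≤-trans (d-step u′ cp) (≤-trans (s≤s u′c) u′c′)) ⟨
            d u u′              ∎))
      where
      above : ∀ {z} → z ∈ (tt ∷⟨ cp ⟩ geo p y) → d u c′ < d u z
      above z∈ = subst (_< d u _) (≡-sym uc′) (far z∈)
      u′c′ : k < d u′ c′
      u′c′ = far′ (∈-++⁺ʳ (geo x c′) (inj₁ refl))
      u′p : k < d u′ p
      u′p = far′ (∈-++⁺ʳ (geo x c′) (inj₂ (first∈ (geo p y))))
      u′c : d u′ c ≤ k
      u′c with near u′
      ... | inj₁ h = h
      ... | inj₂ h = contradiction h (<⇒≱ u′c′)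

    -- If u is far from a geodesic through c, then c′ is a midpoint of x and y as well, and a common
    -- neighbour of c and c′ towards y serves both geodesics; a vertex far from the geodesic
    -- through c′ would then be at distance more than 2k from u.
    edge-cover : ∀ {c c′} → Adj c c′ → (∀ v → d v c ≤ k ⊎ d v c′ ≤ k) →
                 d x y ≡ k + k → d x c ≡ k → d c y ≡ k → CoveringGeodesic
    edge-cover {c} {c′} e near D≡ xc cy = main (d c y) refl
      where
      main : ∀ m → d c y ≡ m → CoveringGeodesic
      -- With `k` equal to 0 the diameter would be 0, against the edge from `c` to `c′`.
      main zero cy≡0 = contradiction (≤-antisym (≤-trans (diam c c′)
                         (≤-reflexive (trans D≡ (cong₂ _+_ k≡0 k≡0)))) z≤n) (adj⇒d≢0 e)
        where
        k≡0 : k ≡ 0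
        k≡0 = trans (≡-sym cy) cy≡0
      main (suc m) cy≡ with next cy≡
      ... | p , cp , py with covers? k (geo x c ++ (tt ∷⟨ cp ⟩ geo p y))
      ...   | inj₁ cov = shortened _ (≤-reflexive (trans (cong₂ _+_ xc
                           (trans (cong suc py) (trans (≡-sym cy≡) cy))) (≡-sym D≡))) cov
      ...   | inj₂ (u , far) = two-midpoints near D≡ cp (lower-neighbour e cp cy≡ (trans c′y k≡) py)
                                 (trans (cong suc py) (≡-sym k≡)) c′x uc′ fary
        where
        k≡ : k ≡ suc m
        k≡ = trans (≡-sym cy) cy≡
        farx : Far k u (geo x c)
        farx z∈ = far (∈-++⁺ˡ (geo x c) z∈)
        fary : Far k u (tt ∷⟨ cp ⟩ geo p y)
        fary z∈ = far (∈-++⁺ʳ (geo x c) z∈)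
        uc : k < d u c
        uc = fary (inj₁ refl)
        uc′ : d u c′ ≡ k
        uc′ with near u
        ... | inj₁ h = contradiction h (<⇒≱ uc)
        ... | inj₂ h = ≤-antisym h (≤-pred (≤-trans uc (d-step u (adj-sym e))))
        -- All of `r` is farther than `k` from `u`, so `c′` lies between `u` and `z` at distance `k`
        -- from `u`; the diameter leaves at most `k` for the rest.
        toward : ∀ {z l} (r : Walk G c z l) → Far k u r → d c′ z ≤ k
        toward {z} r far = +-cancelˡ-≤ k _ _ (begin
          k + d c′ z        ≡⟨ cong (_+ d c′ z) (≡-sym uc′) ⟩
          d u c′ + d c′ z   ≡⟨ gate u (tt ∷⟨ adj-sym e ⟩ r)
                                 (λ { (inj₁ eq) → inj₁ eq
                                    ; (inj₂ z∈) → inj₂ (subst (_< d u _) (≡-sym uc′) (far z∈)) }) ⟩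
          d u z             ≤⟨ diam u z ⟩
          d x y             ≡⟨ D≡ ⟩
          k + k             ∎)
        c′x : d c′ x ≤ k
        c′x = toward (reverse (geo x c)) (λ z∈ → farx (∈-reverse⁻ (geo x c) z∈))
        c′y : d c′ y ≡ k
        c′y = ≤-antisym (toward (tt ∷⟨ cp ⟩ geo p y) fary) (+-cancelˡ-≤ k _ _ (begin
          k + k             ≡⟨ D≡ ⟨
          d x y             ≤⟨ d-triangle x c′ y ⟩
          d x c′ + d c′ y   ≡⟨ cong (_+ d c′ y) (d-sym x c′) ⟩
          d c′ x + d c′ y   ≤⟨ +-monoˡ-≤ (d c′ y) c′x ⟩
          k + d c′ y        ∎))

    -- Cutting down the covering geodesic.

    near-first : ∀ {a p b l v} (e : Adj a p) (q : Walk G p b l) → Covers k (tt ∷⟨ e ⟩ q) →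
                 Far k v q → d v a ≡ k
    near-first {v = v} e q c far with c v
    -- The neighbour `p` of `a` is farther than `k` from `v`, so `a` is at distance at least `k`.
    ... | z , inj₁ refl , h = ≤-antisym h (≤-pred (≤-trans (far (first∈ q)) (d-step v e)))
    ... | z , inj₂ z∈ , h = contradiction h (<⇒≱ (far z∈))

    -- Both `d v a` and `d v′ b` equal `k`. `gate` at `b` gives `d v′ a` as `k + d b a`, and
    -- `joined` at `a` adds `d v a` to it.
    private-ends : ∀ {a b p p′ l v v′} (e : Adj a p) (e′ : Adj b p′)
                   (w : Walk G p b (suc l)) (w′ : Walk G p′ a (suc l)) →
                   (∀ {z} → z ∈ (tt ∷⟨ e ⟩ w) → z ∈ (tt ∷⟨ e′ ⟩ w′)) → Covers k (tt ∷⟨ e ⟩ w) →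
                   d a b ≡ suc (suc l) → Far k v w → Far k v′ w′ → k + (k + suc (suc l)) ≤ d x y
    private-ends {a} {b} {p} {p′} {l} {v} {v′} e e′ w w′ w⊆w′ c ab far far′ = begin
      k + (k + suc (suc l))     ≡⟨ cong₂ (λ s t → k + (s + t)) (≡-sym v′b) (≡-sym ba) ⟩
      k + (d v′ b + d b a)      ≡⟨ cong (k +_) v′a ⟩
      k + d v′ a                ≡⟨ cong (_+ d v′ a) va ⟨
      d v a + d v′ a            ≡⟨ joined e w (λ z∈ → subst (_< d v _) (≡-sym va) (far z∈))
                                     (subst (_< d v′ p) (≡-sym v′b) (far′ p∈w′)) p≤a ⟨
      d v v′                    ≤⟨ diam v v′ ⟩
      d x y                     ∎
      where
      ba : d b a ≡ suc (suc l)
      ba = trans (d-sym b a) ab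
      va : d v a ≡ k
      va = near-first e w c far
      v′b : d v′ b ≡ k
      v′b = near-first e′ w′ (covers-mono {p = tt ∷⟨ e ⟩ w} {q = tt ∷⟨ e′ ⟩ w′} w⊆w′ c) far′
      v′a : d v′ b + d b a ≡ d v′ a
      v′a = gate v′ (tt ∷⟨ e′ ⟩ w′)
              (λ { (inj₁ eq) → inj₁ eq
                 ; (inj₂ z∈) → inj₂ (subst (_< d v′ _) (≡-sym v′b) (far′ z∈)) })
      p∈w′ : p ∈ w′
      p∈w′ with w⊆w′ (inj₂ (first∈ w))
      ... | inj₂ p∈ = p∈
      -- Here `a` and `b` would be adjacent, although their distance is at least 2.
      ... | inj₁ refl = contradiction (≤-trans (≤-reflexive (≡-sym ab)) (d-adj e)) λ { (s≤s ()) }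
      p≤a : d v′ p ≤ d v′ a
      p≤a = begin
        d v′ p           ≤⟨ d-triangle v′ b p ⟩
        d v′ b + d b p   ≡⟨ cong (d v′ b +_) (d-sym b p) ⟩
        d v′ b + d p b   ≤⟨ +-monoʳ-≤ (d v′ b) (≤-trans (d-min w) (≤-trans (n≤1+n _) (≤-reflexive (≡-sym ba)))) ⟩
        d v′ b + d b a   ≡⟨ v′a ⟩
        d v′ a           ∎

    tail-dist : ∀ {a p b l} → Adj a p → Walk G p b l → d a b ≡ suc l → d p b ≡ l
    tail-dist {a} {p} {b} e w ab = ≤-antisym (d-min w)
      (≤-pred (≤-trans (≤-reflexive (≡-sym ab)) (d-min (tt ∷⟨ e ⟩ geo p b))))

    shrink : ∀ {a b l} (q : Walk G a b (suc (suc l))) → d a b ≡ suc (suc l) → Covers k q →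
             k + (k + suc (suc l)) ≤ d x y ⊎
             ∃[ a′ ] ∃[ b′ ] Σ (Walk G a′ b′ (suc l)) λ q′ → d a′ b′ ≡ suc l × Covers k q′
    -- Abstracting the reversed walk together with the inclusion exposes the last edge of `q` by
    -- matching, without losing the link to `q`.
    shrink {a} {b} q@(_ ∷⟨ e ⟩ w) ab c with reverse q | (λ {z} → ∈-reverse⁺ q {z})
    ... | (_ ∷⟨ e′ ⟩ w′) | q⊆q′ with covers? k w | covers? k w′
    ...   | inj₁ cw | _ = inj₂ (_ , b , w , tail-dist e w ab , cw)
    ...   | inj₂ _ | inj₁ cw′ =
            inj₂ (_ , a , w′ , tail-dist e′ w′ (trans (d-sym b a) ab) , cw′)
    ...   | inj₂ (_ , far) | inj₂ (_ , far′) =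
            inj₁ (private-ends e e′ w w′ q⊆q′ c ab far far′)

    edge-near : ∀ {a b} (q : Walk G a b 1) → Covers k q → ∀ v → d v a ≤ k ⊎ d v b ≤ k
    edge-near (_ ∷⟨ _ ⟩ [ _ ]) c v with c v
    ... | _ , inj₁ refl , h = inj₁ h
    ... | _ , inj₂ refl , h = inj₂ h

    single-edge : ∀ {a b} (q : Walk G a b 1) → Covers k q → d x y ≡ k + k → CoveringGeodesic
    single-edge {a} {b} q@(_ ∷⟨ e ⟩ [ _ ]) c D≡ with midpoint q c D≡
    ... | _ , inj₁ refl , xs , sy = edge-cover e (edge-near q c) D≡ xs sy
    ... | _ , inj₂ refl , xs , sy = edge-cover (adj-sym e) (Sum.swap ∘ edge-near q c) D≡ xs sy

    covering-geodesic : ∀ {a b} l (q : Walk G a b l) → d a b ≡ l → Covers k q →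
                        k + k ≤ d x y → CoveringGeodesic
    covering-geodesic zero q ab c D≥ =
      large-diameter q c (subst (_≤ d x y) (cong (k +_) (≡-sym (+-identityʳ k))) D≥)
    covering-geodesic (suc zero) q ab c D≥ with k + (k + 1) ≤? d x y
    ... | yes D≥′ = large-diameter q c D≥′
    ... | no D≱ = single-edge q c (≤-antisym (≤-pred (begin
          suc (d x y)    ≤⟨ ≰⇒> D≱ ⟩
          k + (k + 1)    ≡⟨ +-assoc k k 1 ⟨
          k + k + 1      ≡⟨ +-comm (k + k) 1 ⟩
          suc (k + k)    ∎)) D≥)
    covering-geodesic (suc (suc l)) q ab c D≥ = Sum.[ large-diameter q c
      , (λ (_ , _ , q′ , ab′ , c′) → covering-geodesic (suc l) q′ ab′ c′ D≥) ] (shrink q ab c)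

    exists-covering-geodesic : ∀ {a b l} (q : Walk G a b l) → d a b ≡ l → Covers k q → CoveringGeodesic
    exists-covering-geodesic q ab c with k + k ≤? d x y
    ... | yes D≥ = covering-geodesic _ q ab c D≥
    ... | no D≱ = small-diameter (≰⇒> D≱)

-- From covering to eccentricity.

module _ {n : ℕ} (G : SimpleGraph n) (conn : Connected G) where

  open Distance G conn

  near⇒distToPath : ∀ {e v} (P : ShortestPath G) → Near e v (walk P) → DistToPath≤ G v P e
  near⇒distToPath {v = v} P (z , z∈ , h) =
    z , z∈ , d z v , proj₂ (distance z v) , subst (_≤ _) (d-sym v z) h

  distToPath⇒near : ∀ {e v} (P : ShortestPath G) → DistToPath≤ G v P e → Near e v (walk P)
  distToPath⇒near {v = v} P (z , z∈ , l , dist , h) =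
    z , z∈ , subst (_≤ _) (trans (isDist⇒≡d dist) (d-sym z v)) h

  -- The radius is lowered from `j` until some vertex is no longer covered; that vertex attains the
  -- eccentricity.
  ecc-below : ∀ (P : ShortestPath G) j → Covers j (walk P) → ∃[ e ] (e ≤ j × IsEcc G P e)
  -- At radius 0 the lower bound is trivial, so any vertex can be the witness.
  ecc-below P zero c = 0 , z≤n , (λ v → near⇒distToPath P (c v)) , src P , λ _ _ → z≤n
  ecc-below P (suc j) c with covers? j (walk P)
  ... | inj₁ c′ with ecc-below P j c′
  ...   | e , e≤j , ecc = e , m≤n⇒m≤1+n e≤j , ecc
  ecc-below P (suc j) c | inj₂ (v , far) =
    suc j , ≤-refl , (λ v → near⇒distToPath P (c v)) , v ,
    λ e h → case distToPath⇒near P h of λ { (z , z∈ , h′) → ≤-trans (far z∈) h′ }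

theorem1 : ∀ {n} (G : SimpleGraph n) → Connected G → DistanceHereditary G →
    ∀ (x y : Fin n) → Diametral G x y →
    ∀ (k : ℕ) → IsMinEccSP G k →
    ∃[ P ] (src P ≡ x × tgt P ≡ y × IsEcc G P k)
theorem1 G conn dh x y (D , (_ , D-max) , xy) k ((Q , cov , _) , k-min) = result
  where
  open Distance G conn
  open Hereditary G conn dh

  diam : ∀ u v → d u v ≤ d x y
  diam u v = subst (d u v ≤_) (isDist⇒≡d xy) (D-max u v (d u v) (proj₂ (distance u v)))

  result : ∃[ P ] (src P ≡ x × tgt P ≡ y × IsEcc G P k)
  result with Diameter.exists-covering-geodesic {x} {y} diam k (walk Q)
                (≡-sym (isDist⇒≡d (isShortest Q))) (λ v → distToPath⇒near G conn Q (cov v))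
  ... | p , c with ecc-below G conn (sp (d x y) p (p , proj₂ (proj₂ (distance x y)))) k c
  -- Covering within `k` gives `e ≤ k`; minimality of `k` over all shortest paths gives the
  -- converse.
  ...   | e , e≤k , ecc = P , refl , refl , subst (IsEcc G P) (≤-antisym e≤k (k-min P e ecc)) ecc
    where
    P : ShortestPath G
    P = sp (d x y) p (p , proj₂ (proj₂ (distance x y)))
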